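{- For every positive integer $l'$ there is a constant $C_{l'}$ such that for all $n\ge l'$, every $(n-l')$-trace $l'$-Sperner family $\mathcal{F}\subseteq 2^{[n]}$ satisfies $|\mathcal{F}|\le C_{l'}\, n^{ -1/3}\binom{n}{\lfloor n/2\rfloor}$.
   Context: $[n]=\{1,\dots,n\}$. A chain of length $m$ is a sequence of sets $F_1\subsetneq\dots\subsetneq F_m$; a family is $k$-Sperner if it contains no chain of length $k+1$. For a family $\mathcal{F}$ and a set $X$, $\mathcal{F}|_X=\{F\cap X:F\in\mathcal{F}\}$. A family $\mathcal{F}\subseteq 2^{[n]}$ is $l$-trace $k$-Sperner if $\mathcal{F}|_L$ is $k$-Sperner for every $l$-element $L\subseteq[n]$. -}

module Defs where

open import Data.Nat using (ℕ; suc; _∸_)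
open import Data.Fin using (Fin; inject₁) renaming (suc to fsuc)
open import Data.Fin.Subset using (Subset; _∩_; _⊂_; ∣_∣)
open import Data.List using (List)
open import Data.List.Membership.Propositional using (_∈_)
open import Data.Product using (Σ; ∃; _×_)
open import Relation.Binary.PropositionalEquality using (_≡_)
open import Relation.Nullary using (¬_)

-- A family of subsets of [n], given as a list of subsets (duplicate-freeness
-- is imposed separately in the statement, so that |F| = length).
Family : ℕ → Set
Family n = List (Subset n)

InTrace : ∀ {n} → Family n → Subset n → Subset n → Set
InTrace 𝓕 X G = ∃ λ F → F ∈ 𝓕 × G ≡ F ∩ X

ChainInTrace : ∀ {n} → Family n → Subset n → (k : ℕ) → (Fin (suc k) → Subset n) → Set
ChainInTrace 𝓕 X k G =
  (∀ i → InTrace 𝓕 X (G i)) × (∀ (i : Fin k) → G (inject₁ i) ⊂ G (fsuc i))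

TraceSperner : ∀ {n} → Family n → Subset n → ℕ → Set
TraceSperner 𝓕 X k = ∀ (G : Fin (suc k) → Subset _) → ¬ ChainInTrace 𝓕 X k G

TraceKSperner : ∀ {n} → ℕ → ℕ → Family n → Set
TraceKSperner {n} l k 𝓕 = ∀ (L : Subset n) → ∣ L ∣ ≡ l → TraceSperner 𝓕 L k

{-# OPTIONS --safe #-}
-- Call a swap of F the replacement of one point y ∈ F by one z ∉ F.  After l successive swaps
-- with 2l distinct points yᵢ, zᵢ, deleting L = {y₁,…,yₗ} leaves a strict chain of l + 1 traces,
-- so 𝓕 contains no such sequence.  Put 𝓗₀ = 𝓕 and let 𝓗ᵢ₊₁ consist of the sets in 𝓗ᵢ from which
-- one can swap into 𝓗ᵢ in enough ways to avoid 2l prescribed points; greedily, 𝓗ₗ = ∅.  A set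
-- F ∈ 𝓗ᵢ \ 𝓗ᵢ₊₁ has at least n − 2l hypercube neighbours A, each with at most 2l neighbours of
-- size |F| in 𝓗ᵢ, so by double counting n |𝓗ᵢ \ 𝓗ᵢ₊₁| = O(l 2ⁿ).  Hence n |𝓕| = O(l² 2ⁿ), and
-- 2ⁿ = O(n^{2/3}) (n choose n/2) suffices.
module Submission where

open import Defs
open import Data.Nat using (ℕ; _≤_; _*_; _^_; _∸_; _/_; NonZero)
open import Data.Nat.Combinatorics using (_C_)
open import Data.List using (length)
open import Data.List.Relation.Unary.Unique.Propositional using (Unique)
open import Data.Product using (∃)

import Algebra.Properties.CommutativeMonoid.Sum
open import Data.Bool using (Bool; true; false; not; _∧_; if_then_else_)
import Data.Bool as Bool
open import Data.Bool.Properties using (∧-zeroʳ; ∧-identityʳ; not-involutive; T-≡)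
open import Data.Fin using (Fin; zero; suc; inject₁)
import Data.Fin.Properties as Fin
open import Data.Fin.Subset using (Subset; _∈_; _∉_; _⊆_; _⊂_; _∩_; _∪_; ∁; ⁅_⁆; ∣_∣; ⊥)
open import Data.Fin.Subset.Properties
open import Data.List using ([]; _∷_)
import Data.List.Membership.DecPropositional as DecMembership
import Data.List.Relation.Unary.All.Properties as All
open import Data.List.Relation.Unary.AllPairs using ([]; _∷_)
open import Data.Nat using (zero; suc; _+_; _<_; _<ᵇ_; _%_; s≤s; z≤n; >-nonZero; >-nonZero⁻¹)
open import Data.Nat.Combinatorics using (nCk+nC[k+1]≡[n+1]C[k+1]; nCk≡nC[n∸k]; nC1≡n)
open import Data.Nat.DivMod using (m≡m%n+[m/n]*n; m%n<n)
open import Data.Nat.Properties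
open import Data.Nat.Tactic.RingSolver using (solve-∀)
open import Data.Product using (_×_; _,_; proj₁; proj₂)
open import Data.Sum using (inj₁; inj₂; [_,_]′)
open import Data.Vec using ([]; _∷_; lookup; tabulate; updateAt)
open import Data.Vec.Properties using (lookup⇒[]=; []=⇒lookup; lookup∘tabulate; lookup∘updateAt; lookup∘updateAt′; updateAt-updateAt-local; updateAt-id; ≡-dec)
import Data.Vec.Functional as Vector
open import Function using (_∘_; id; Equivalence)
open import Relation.Binary.PropositionalEquality using (_≡_; _≢_; _≗_; refl; sym; trans; cong; cong₂; subst)
open import Relation.Nullary using (Dec; yes; no; does; contradiction; ¬?)
open import Relation.Nullary.Decidable using (_×-dec_)

open Algebra.Properties.CommutativeMonoid.Sum +-0-commutativeMonoid using (sum; ∑-distrib-+; sum-cong-≗)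
open ≤-Reasoning

private
  variable
    n : ℕ

-- Central binomial coefficients

-- Pascal's rule splits the left side, induction on `n` turns both parts into multiples of `suc n`,
-- and Pascal's rule rejoins them; the spare `a` supplies the last unit of `suc (suc n)`.
absorption : ∀ n k → suc k * (suc n C suc k) ≡ suc n * (n C k)
absorption zero    zero    = refl
absorption zero    (suc k) = *-zeroʳ (suc (suc k))
absorption (suc n) zero    = trans (+-identityʳ _) (trans (nC1≡n (suc (suc n))) (sym (*-identityʳ _)))
absorption (suc n) (suc k) = begin-equality
  suc (suc k) * (suc (suc n) C suc (suc k))
    ≡⟨ cong (suc (suc k) *_) (nCk+nC[k+1]≡[n+1]C[k+1] (suc n) (suc k)) ⟨
  suc (suc k) * (a + b)
    ≡⟨ expand k a b ⟩
  a + suc k * a + suc (suc k) * b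
    ≡⟨ cong₂ (λ u v → a + u + v) (absorption n k) (absorption n (suc k)) ⟩
  a + suc n * (n C k) + suc n * (n C suc k)
    ≡⟨ collect n a (n C k) (n C suc k) ⟩
  a + suc n * (n C k + n C suc k)
    ≡⟨ cong (λ u → a + suc n * u) (nCk+nC[k+1]≡[n+1]C[k+1] n k) ⟩
  suc (suc n) * a ∎
  where
  a = suc n C suc k
  b = suc n C suc (suc k)
  expand : ∀ k a b → suc (suc k) * (a + b) ≡ a + suc k * a + suc (suc k) * b
  expand = solve-∀
  collect : ∀ n a u v → a + suc n * u + suc n * v ≡ a + suc n * (u + v)
  collect = solve-∀

middle-pair : ∀ k → suc (k + k) C k ≡ suc (k + k) C suc k
middle-pair k = trans (nCk≡nC[n∸k] (m≤n⇒m≤1+n (m≤m+n k k)))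
  (cong (suc (k + k) C_) (trans (cong (_∸ k) (sym (+-suc k k))) (m+n∸m≡n k (suc k))))

central-double : ∀ k → (suc k + suc k) C suc k ≡ 2 * (suc (k + k) C k)
central-double k = begin-equality
  (suc k + suc k) C suc k                     ≡⟨ cong (λ m → suc m C suc k) (+-suc k k) ⟩
  suc (suc (k + k)) C suc k                   ≡⟨ nCk+nC[k+1]≡[n+1]C[k+1] (suc (k + k)) k ⟨
  suc (k + k) C k + suc (k + k) C suc k       ≡⟨ cong (suc (k + k) C k +_) (middle-pair k) ⟨
  suc (k + k) C k + suc (k + k) C k           ≡⟨ cong (suc (k + k) C k +_) (+-identityʳ _) ⟨
  2 * (suc (k + k) C k)                       ∎

central-step : ∀ k → suc k * ((suc k + suc k) C suc k) ≡ 2 * suc (k + k) * ((k + k) C k)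
central-step k = begin-equality
  suc k * ((suc k + suc k) C suc k)        ≡⟨ cong (suc k *_) (central-double k) ⟩
  suc k * (2 * (suc (k + k) C k))          ≡⟨ cong (λ m → suc k * (2 * m)) (middle-pair k) ⟩
  suc k * (2 * (suc (k + k) C suc k))      ≡⟨ shuffle (suc k) (suc (k + k) C suc k) ⟩
  2 * (suc k * (suc (k + k) C suc k))      ≡⟨ cong (2 *_) (absorption (k + k) k) ⟩
  2 * (suc (k + k) * ((k + k) C k))        ≡⟨ *-assoc 2 (suc (k + k)) ((k + k) C k) ⟨
  2 * suc (k + k) * ((k + k) C k)          ∎
  where
  shuffle : ∀ a b → a * (2 * b) ≡ 2 * (a * b)
  shuffle = solve-∀

4^[2+2k] : ∀ k → 4 ^ (suc k + suc k) ≡ 16 * 4 ^ (k + k)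
4^[2+2k] k = trans (cong (λ m → 4 * 4 ^ m) (+-suc k k)) (sym (*-assoc 4 4 (4 ^ (k + k))))

-- This is the bound `2^(2k) ≤ 2 √k c`, squared to stay in ℕ. It is an equality at `k = 1` and false
-- at `k = 0`, hence the index `j`.
4^2k≤ : ∀ j → let k = suc j ; c = (k + k) C k in 4 ^ (k + k) ≤ 4 * k * (c * c)
4^2k≤ zero    = ≤-refl
4^2k≤ (suc j) = *-cancelˡ-≤ (suc k) (begin
  suc k * 4 ^ (suc k + suc k)                      ≡⟨ cong (suc k *_) (4^[2+2k] k) ⟩
  suc k * (16 * 4 ^ (k + k))                       ≤⟨ *-monoʳ-≤ (suc k) (*-monoʳ-≤ 16 (4^2k≤ j)) ⟩
  -- The added term completes a square: `64 k (k + 1) + 16 = 16 (2k + 1)²`.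
  suc k * (16 * (4 * k * (c * c)))                 ≤⟨ m≤m+n _ (16 * (c * c)) ⟩
  suc k * (16 * (4 * k * (c * c))) + 16 * (c * c)  ≡⟨ square k c ⟩
  4 * ((2 * suc (k + k) * c) * (2 * suc (k + k) * c))
                                                   ≡⟨ cong (λ m → 4 * (m * m)) (central-step k) ⟨
  4 * ((suc k * c′) * (suc k * c′))                ≡⟨ regroup (suc k) c′ ⟩
  suc k * (4 * suc k * (c′ * c′))                  ∎)
  where
  k = suc j
  c = (k + k) C k
  c′ = (suc k + suc k) C suc k
  square : ∀ k c → suc k * (16 * (4 * k * (c * c))) + 16 * (c * c)
                 ≡ 4 * ((2 * suc (k + k) * c) * (2 * suc (k + k) * c))
  square = solve-∀
  regroup : ∀ m c → 4 * ((m * c) * (m * c)) ≡ m * (4 * m * (c * c))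
  regroup = solve-∀

-- The central coefficient of the next even row is exactly `2 * d`, so the even bound for `suc k`
-- can be divided by 4.
4^[1+2k]≤ : ∀ k → let d = suc (k + k) C k in 4 ^ suc (k + k) ≤ 4 * suc k * (d * d)
4^[1+2k]≤ k = *-cancelˡ-≤ 4 (begin
  4 * 4 ^ suc (k + k)                      ≡⟨ cong (λ m → 4 * 4 ^ m) (+-suc k k) ⟨
  4 ^ (suc k + suc k)                      ≤⟨ 4^2k≤ k ⟩
  4 * suc k * (c * c)                      ≡⟨ cong (λ m → 4 * suc k * (m * m)) (central-double k) ⟩
  4 * suc k * ((2 * d) * (2 * d))          ≡⟨ regroup (suc k) d ⟩
  4 * (4 * suc k * (d * d))                ∎)
  where
  c = (suc k + suc k) C suc k
  d = suc (k + k) C k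
  regroup : ∀ m d → 4 * m * ((2 * d) * (2 * d)) ≡ 4 * (4 * m * (d * d))
  regroup = solve-∀

-- The even and odd cases give the factors `4 * k` and `4 * suc k`; both are at most `4 * n`.
4^n≤ : ∀ n .{{_ : NonZero n}} → let c = n C (n / 2) in 4 ^ n ≤ 4 * n * (c * c)
4^n≤ n = go (n % 2) (n / 2) (m%n<n n 2) (m≡m%n+[m/n]*n n 2)
  where
  double : ∀ q → q * 2 ≡ q + q
  double = solve-∀
  go : ∀ r q → r < 2 → n ≡ r + q * 2 → 4 ^ n ≤ 4 * n * ((n C q) * (n C q))
  go zero zero _ eq = contradiction (subst (0 <_) eq (>-nonZero⁻¹ n)) λ ()
  go zero (suc j) _ eq rewrite trans eq (double (suc j)) = begin
    4 ^ (k + k)               ≤⟨ 4^2k≤ j ⟩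
    4 * k * (c * c)           ≤⟨ *-monoˡ-≤ (c * c) (*-monoʳ-≤ 4 (m≤m+n k k)) ⟩
    4 * (k + k) * (c * c)     ∎
    where
    k = suc j
    c = (k + k) C k
  go (suc zero) k _ eq rewrite trans eq (cong suc (double k)) = begin
    4 ^ suc (k + k)             ≤⟨ 4^[1+2k]≤ k ⟩
    4 * suc k * (d * d)         ≤⟨ *-monoˡ-≤ (d * d) (*-monoʳ-≤ 4 (s≤s (m≤m+n k k))) ⟩
    4 * suc (k + k) * (d * d)   ∎
    where
    d = suc (k + k) C k
  go (suc (suc _)) _ (s≤s (s≤s ())) _

4^n≡2^n*2^n : ∀ n → 4 ^ n ≡ 2 ^ n * 2 ^ n
4^n≡2^n*2^n zero    = refl
4^n≡2^n*2^n (suc n) = trans (cong (4 *_) (4^n≡2^n*2^n n)) (regroup (2 ^ n))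
  where
  regroup : ∀ a → 4 * (a * a) ≡ (2 * a) * (2 * a)
  regroup = solve-∀

square-cancel-≤ : ∀ {a b} → a * a ≤ b * b → a ≤ b
square-cancel-≤ a²≤b² = ≮⇒≥ λ b<a → <⇒≱ (*-mono-< b<a b<a) a²≤b²

-- The product of the bound for `(2 ^ n)²` and a cruder one for `2 ^ n`. The integral exponent of
-- `n` avoids roots and leaves one factor `n` to gain from `n³` in the theorem.
[2^n]³≤ : ∀ n .{{_ : NonZero n}} → (2 ^ n) ^ 3 ≤ 8 * (n * n) * (n C (n / 2)) ^ 3
[2^n]³≤ n = begin
  (2 ^ n) ^ 3                          ≡⟨ cube (2 ^ n) ⟩
  2 ^ n * 2 ^ n * 2 ^ n                ≤⟨ *-mono-≤ squared linear ⟩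
  4 * n * (c * c) * (2 * n * c)        ≡⟨ regroup n c ⟩
  8 * (n * n) * c ^ 3                  ∎
  where
  c = n C (n / 2)
  squared : 2 ^ n * 2 ^ n ≤ 4 * n * (c * c)
  squared = subst (_≤ 4 * n * (c * c)) (4^n≡2^n*2^n n) (4^n≤ n)
  spread : ∀ n c → n * (4 * n * (c * c)) ≡ (2 * n * c) * (2 * n * c)
  spread = solve-∀
  linear : 2 ^ n ≤ 2 * n * c
  -- A further factor `n` makes the right side of `squared` a perfect square.
  linear = square-cancel-≤ (≤-trans squared
    (≤-trans (m≤n*m _ n) (≤-reflexive (spread n c))))
  cube : ∀ a → a * (a * (a * 1)) ≡ a * a * a
  cube = solve-∀
  regroup : ∀ n c → 4 * n * (c * c) * (2 * n * c) ≡ 8 * (n * n) * (c * (c * (c * 1)))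
  regroup = solve-∀

-- Sums over points and over subsets

𝟙 : Bool → ℕ
𝟙 b = if b then 1 else 0

sum-mono : {f g : Fin n → ℕ} → (∀ i → f i ≤ g i) → sum f ≤ sum g
sum-mono {zero}  f≤g = z≤n
sum-mono {suc n} f≤g = +-mono-≤ (f≤g zero) (sum-mono (f≤g ∘ suc))

sum-const : ∀ n c → sum {n} (λ _ → c) ≡ n * c
sum-const zero    c = refl
sum-const (suc n) c = cong (c +_) (sum-const n c)

∣tabulate∣ : (p : Fin n → Bool) → ∣ tabulate p ∣ ≡ sum (𝟙 ∘ p)
∣tabulate∣ {zero}  p = refl
∣tabulate∣ {suc n} p with p zero
... | true  = cong suc (∣tabulate∣ (p ∘ suc))
... | false = ∣tabulate∣ (p ∘ suc)

-- Splitting the hypercube by its first coordinate turns the flip of that coordinate into an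
-- exchange of the two halves.
∑⊆ : ∀ n → (Subset n → ℕ) → ℕ
∑⊆ zero    f = f []
∑⊆ (suc n) f = ∑⊆ n (f ∘ (false ∷_)) + ∑⊆ n (f ∘ (true ∷_))

∑⊆-mono : {f g : Subset n → ℕ} → (∀ A → f A ≤ g A) → ∑⊆ n f ≤ ∑⊆ n g
∑⊆-mono {zero}  f≤g = f≤g []
∑⊆-mono {suc n} f≤g = +-mono-≤ (∑⊆-mono (f≤g ∘ (false ∷_))) (∑⊆-mono (f≤g ∘ (true ∷_)))

∑⊆-cong : {f g : Subset n → ℕ} → f ≗ g → ∑⊆ n f ≡ ∑⊆ n g
∑⊆-cong {zero}  f≗g = f≗g []
∑⊆-cong {suc n} f≗g = cong₂ _+_ (∑⊆-cong (f≗g ∘ (false ∷_))) (∑⊆-cong (f≗g ∘ (true ∷_)))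

∑⊆-distrib-+ : (f g : Subset n → ℕ) → ∑⊆ n (λ A → f A + g A) ≡ ∑⊆ n f + ∑⊆ n g
∑⊆-distrib-+ {zero}  f g = refl
∑⊆-distrib-+ {suc n} f g = trans
  (cong₂ _+_ (∑⊆-distrib-+ (f ∘ (false ∷_)) (g ∘ (false ∷_))) (∑⊆-distrib-+ (f ∘ (true ∷_)) (g ∘ (true ∷_))))
  (interchange (∑⊆ n (f ∘ (false ∷_))) _ _ _)
  where
  interchange : ∀ a b c d → (a + b) + (c + d) ≡ (a + c) + (b + d)
  interchange = solve-∀

∑⊆-const : ∀ n c → ∑⊆ n (λ _ → c) ≡ c * 2 ^ n
∑⊆-const zero    c = sym (*-identityʳ c)
∑⊆-const (suc n) c = trans (cong₂ _+_ (∑⊆-const n c) (∑⊆-const n c)) (regroup c (2 ^ n))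
  where
  regroup : ∀ c a → c * a + c * a ≡ c * (2 * a)
  regroup = solve-∀

*-distribˡ-∑⊆ : ∀ c (f : Subset n → ℕ) → ∑⊆ n (λ A → c * f A) ≡ c * ∑⊆ n f
*-distribˡ-∑⊆ {zero}  c f = refl
*-distribˡ-∑⊆ {suc n} c f = trans
  (cong₂ _+_ (*-distribˡ-∑⊆ c (f ∘ (false ∷_))) (*-distribˡ-∑⊆ c (f ∘ (true ∷_))))
  (sym (*-distribˡ-+ c (∑⊆ n (f ∘ (false ∷_))) (∑⊆ n (f ∘ (true ∷_)))))

∑⊆-sum-comm : ∀ {m} (f : Subset n → Fin m → ℕ) →
              ∑⊆ n (λ A → sum (f A)) ≡ sum (λ x → ∑⊆ n (λ A → f A x))
∑⊆-sum-comm {zero}  f = refl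
∑⊆-sum-comm {suc n} f = trans
  (cong₂ _+_ (∑⊆-sum-comm (f ∘ (false ∷_))) (∑⊆-sum-comm (f ∘ (true ∷_))))
  (sym (∑-distrib-+ (λ x → ∑⊆ n (λ A → f (false ∷ A) x)) (λ x → ∑⊆ n (λ A → f (true ∷ A) x))))

flip : Fin n → Subset n → Subset n
flip x A = updateAt A x not

flip-involutive : ∀ x (A : Subset n) → flip x (flip x A) ≡ A
flip-involutive x A = trans
  (updateAt-updateAt-local x A (not-involutive (lookup A x))) (updateAt-id x A)

-- `flip x` permutes the hypercube. This moves a count from sets to their neighbours.
∑⊆-flip : ∀ x (f : Subset n → ℕ) → ∑⊆ n (f ∘ flip x) ≡ ∑⊆ n f
∑⊆-flip {suc n} zero    f = +-comm (∑⊆ n (f ∘ (true ∷_))) (∑⊆ n (f ∘ (false ∷_)))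
∑⊆-flip {suc n} (suc x) f = cong₂ _+_ (∑⊆-flip x (f ∘ (false ∷_))) (∑⊆-flip x (f ∘ (true ∷_)))

# : (Subset n → Bool) → ℕ
# {n} h = ∑⊆ n (𝟙 ∘ h)

infix 4 _≟ˢ_
_≟ˢ_ : (A B : Subset n) → Dec (A ≡ B)
_≟ˢ_ = ≡-dec Bool._≟_

#-singleton : (B : Subset n) → 1 ≤ # (λ A → does (A ≟ˢ B))
#-singleton []          = ≤-refl
#-singleton (false ∷ B) = m≤n⇒m≤n+o _ (#-singleton B)
#-singleton (true ∷ B)  = m≤n⇒m≤o+n _ (#-singleton B)

module _ {n : ℕ} where
  open DecMembership (_≟ˢ_ {n}) public using () renaming (_∈?_ to _∈ᴸ?_)

-- Passage from lists to Boolean predicates. Uniqueness keeps the indicators of head and tail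
-- disjoint.
length≤# : (𝓕 : Family n) → Unique 𝓕 → length 𝓕 ≤ # (λ A → does (A ∈ᴸ? 𝓕))
length≤# []      _            = z≤n
length≤# (B ∷ 𝓕) (B∉𝓕 ∷ uniq) = begin
  1 + length 𝓕
    ≤⟨ +-mono-≤ (#-singleton B) (length≤# 𝓕 uniq) ⟩
  # (λ A → does (A ≟ˢ B)) + # (λ A → does (A ∈ᴸ? 𝓕))
    ≡⟨ ∑⊆-distrib-+ (λ A → 𝟙 (does (A ≟ˢ B))) (λ A → 𝟙 (does (A ∈ᴸ? 𝓕))) ⟨
  ∑⊆ _ (λ A → 𝟙 (does (A ≟ˢ B)) + 𝟙 (does (A ∈ᴸ? 𝓕)))
    ≤⟨ ∑⊆-mono disjoint ⟩
  # (λ A → does (A ∈ᴸ? (B ∷ 𝓕))) ∎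
  where
  disjoint : ∀ A → 𝟙 (does (A ≟ˢ B)) + 𝟙 (does (A ∈ᴸ? 𝓕)) ≤ 𝟙 (does (A ∈ᴸ? (B ∷ 𝓕)))
  disjoint A with A ≟ˢ B | A ∈ᴸ? 𝓕
  ... | yes refl | yes A∈𝓕 = contradiction A∈𝓕 (All.All¬⇒¬Any B∉𝓕)
  ... | yes refl | no  _   = ≤-refl
  ... | no  _    | yes _   = ≤-refl
  ... | no  _    | no  _   = ≤-refl

-- Rich sets

<ᵇ-false⇒≥ : ∀ a b → (a <ᵇ b) ≡ false → b ≤ a
<ᵇ-false⇒≥ a b eq = ≮⇒≥ λ a<b → subst Bool.T eq (<⇒<ᵇ a<b)

-- `t` is the number of points that a choice must be able to avoid: more than `t` candidates always
-- leave one outside a set of size at most `t`.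
module Richness {n : ℕ} (t : ℕ) where

  -- For `b = true` the flip removes `x` and leads one level down; for `b = false` it leads one
  -- level up.
  neighbour : (Subset n → Bool) → Bool → Subset n → Fin n → Bool
  neighbour h b A x = does (lookup A x Bool.≟ b) ∧ h (flip x A)

  degree : (Subset n → Bool) → Bool → Subset n → ℕ
  degree h b A = ∣ tabulate (neighbour h b A) ∣

  -- After x is flipped, flipping some x′ with the value x now has restores the size of A.
  swappable : (Subset n → Bool) → Subset n → Fin n → Bool
  swappable h A x = t <ᵇ degree h (not (lookup A x)) (flip x A)

  rich : (Subset n → Bool) → Subset n → Bool
  rich h A = h A ∧ (t <ᵇ ∣ tabulate (swappable h A) ∣)

  -- Applied to membership in `𝓕`, `rich^ i` is the family 𝓗ᵢ of the overview.
  rich^ : ℕ → (Subset n → Bool) → Subset n → Bool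
  rich^ zero    h = h
  rich^ (suc k) h = rich (rich^ k h)

  unswappable-total : (Subset n → Bool) → ℕ
  unswappable-total h = ∑⊆ n (λ A → sum (λ x → 𝟙 (h A ∧ not (swappable h A x))))

  -- If `p` holds at more than `t` points, every term vanishes; otherwise the sum is the number of
  -- these points.
  light-∑≤ : (p : Fin n → Bool) → sum (λ x → 𝟙 (p x ∧ not (t <ᵇ ∣ tabulate p ∣))) ≤ t
  light-∑≤ p with t <ᵇ ∣ tabulate p ∣ in eq
  ... | true  = begin
    sum (λ x → 𝟙 (p x ∧ false))  ≡⟨ sum-cong-≗ (λ x → cong 𝟙 (∧-zeroʳ (p x))) ⟩
    sum {n} (λ _ → 0)            ≡⟨ sum-const n 0 ⟩
    n * 0                        ≡⟨ *-zeroʳ n ⟩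
    0                            ≤⟨ z≤n ⟩
    t                            ∎
  ... | false = begin
    sum (λ x → 𝟙 (p x ∧ true))   ≡⟨ sum-cong-≗ (λ x → cong 𝟙 (∧-identityʳ (p x))) ⟩
    sum (𝟙 ∘ p)                  ≡⟨ ∣tabulate∣ p ⟨
    ∣ tabulate p ∣               ≤⟨ <ᵇ-false⇒≥ t ∣ tabulate p ∣ eq ⟩
    t                            ∎

  -- Double counting by the middle vertex of a swap. Such a vertex is charged only by its neighbours
  -- in `h` on a side with at most `t` of them, hence at most `t` times for each of the two sides.
  unswappable-total≤ : ∀ h → unswappable-total h ≤ (t + t) * 2 ^ n
  unswappable-total≤ h = begin
    unswappable-total h
      ≡⟨ ∑⊆-sum-comm (λ A x → 𝟙 (h A ∧ not (swappable h A x))) ⟩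
    sum (λ x → ∑⊆ n (λ A → 𝟙 (h A ∧ not (swappable h A x))))
      -- After substituting `flip x A` for `A`, the variable `A` stands for the middle vertex.
      ≡⟨ sum-cong-≗ (λ x → trans (sym (∑⊆-flip x _)) (∑⊆-cong (λ A → cong 𝟙 (recentre x A)))) ⟩
    sum (λ x → ∑⊆ n (λ A → 𝟙 (light A x)))
      ≡⟨ ∑⊆-sum-comm (λ A x → 𝟙 (light A x)) ⟨
    ∑⊆ n (λ A → sum (λ x → 𝟙 (light A x)))
      ≤⟨ ∑⊆-mono (λ A → ≤-trans (sum-mono (split A))
           (≤-trans (≤-reflexive (∑-distrib-+ (λ x → 𝟙 (lightIn A true x)) (λ x → 𝟙 (lightIn A false x))))
             (+-mono-≤ (light-∑≤ (neighbour h true A)) (light-∑≤ (neighbour h false A))))) ⟩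
    ∑⊆ n (λ _ → t + t)
      ≡⟨ ∑⊆-const n (t + t) ⟩
    (t + t) * 2 ^ n ∎
    where
    light : Subset n → Fin n → Bool
    light A x = h (flip x A) ∧ not (t <ᵇ degree h (lookup A x) A)
    lightIn : Subset n → Bool → Fin n → Bool
    lightIn A b x = neighbour h b A x ∧ not (t <ᵇ degree h b A)
    recentre : ∀ x A → h (flip x A) ∧ not (swappable h (flip x A) x) ≡ light A x
    recentre x A = cong₂ (λ b B → h (flip x A) ∧ not (t <ᵇ degree h b B))
      (trans (cong not (lookup∘updateAt x A)) (not-involutive (lookup A x)))
      (flip-involutive x A)
    split : ∀ A x → 𝟙 (light A x)
          ≤ 𝟙 (lightIn A true x) + 𝟙 (lightIn A false x)
    split A x with lookup A x
    ... | true  = m≤m+n _ _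
    ... | false = ≤-refl

  -- A set of `h` that is not rich has at most `t` swappable points, so its weight `n` is at most
  -- `t` plus its unswappable points. Summed over all sets, the latter contribute at most
  -- `(t + t) * 2 ^ n`.
  #-rich : ∀ h → n * # h ≤ n * # (rich h) + (t + (t + t)) * 2 ^ n
  #-rich h = begin
    n * # h
      ≡⟨ *-distribˡ-∑⊆ n (𝟙 ∘ h) ⟨
    ∑⊆ n (λ A → n * 𝟙 (h A))
      ≤⟨ ∑⊆-mono pointwise ⟩
    ∑⊆ n (λ A → n * 𝟙 (rich h A) + (t + unswappable A))
      ≡⟨ ∑⊆-distrib-+ (λ A → n * 𝟙 (rich h A)) (λ A → t + unswappable A) ⟩
    ∑⊆ n (λ A → n * 𝟙 (rich h A)) + ∑⊆ n (λ A → t + unswappable A)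
      ≡⟨ cong₂ _+_ (*-distribˡ-∑⊆ n (𝟙 ∘ rich h)) (∑⊆-distrib-+ (λ _ → t) unswappable) ⟩
    n * # (rich h) + (∑⊆ n (λ _ → t) + unswappable-total h)
      ≤⟨ +-monoʳ-≤ (n * # (rich h)) (+-mono-≤ (≤-reflexive (∑⊆-const n t)) (unswappable-total≤ h)) ⟩
    n * # (rich h) + (t * 2 ^ n + (t + t) * 2 ^ n)
      ≡⟨ cong (n * # (rich h) +_) (*-distribʳ-+ (2 ^ n) t (t + t)) ⟨
    n * # (rich h) + (t + (t + t)) * 2 ^ n ∎
    where
    unswappable : Subset n → ℕ
    unswappable A = sum (λ x → 𝟙 (h A ∧ not (swappable h A x)))
    partition : (p : Fin n → Bool) → n ≡ ∣ tabulate p ∣ + sum (λ x → 𝟙 (not (p x)))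
    partition p = begin-equality
      n                                          ≡⟨ *-identityʳ n ⟨
      n * 1                                      ≡⟨ sum-const n 1 ⟨
      sum {n} (λ _ → 1)                          ≡⟨ sum-cong-≗ (λ x → complement (p x)) ⟩
      sum (λ x → 𝟙 (p x) + 𝟙 (not (p x)))        ≡⟨ ∑-distrib-+ (𝟙 ∘ p) (λ x → 𝟙 (not (p x))) ⟩
      sum (𝟙 ∘ p) + sum (λ x → 𝟙 (not (p x)))    ≡⟨ cong (_+ sum (λ x → 𝟙 (not (p x)))) (∣tabulate∣ p) ⟨
      ∣ tabulate p ∣ + sum (λ x → 𝟙 (not (p x))) ∎
      where
      complement : ∀ b → 1 ≡ 𝟙 b + 𝟙 (not b)
      complement true  = refl
      complement false = refl
    pointwise : ∀ A → n * 𝟙 (h A) ≤ n * 𝟙 (rich h A) + (t + unswappable A)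
    pointwise A with h A
    ... | false = ≤-trans (≤-reflexive (*-zeroʳ n)) z≤n
    ... | true with t <ᵇ ∣ tabulate (swappable h A) ∣ in eq
    ...   | true  = m≤m+n _ _
    ...   | false = begin
      n * 1
        ≡⟨ *-identityʳ n ⟩
      n
        ≡⟨ partition (swappable h A) ⟩
      ∣ tabulate (swappable h A) ∣ + sum (λ x → 𝟙 (not (swappable h A x)))
        ≤⟨ +-monoˡ-≤ _ (<ᵇ-false⇒≥ t ∣ tabulate (swappable h A) ∣ eq) ⟩
      t + sum (λ x → 𝟙 (not (swappable h A x)))
        ≤⟨ m≤n+m _ (n * 0) ⟩
      n * 0 + (t + sum (λ x → 𝟙 (not (swappable h A x)))) ∎

  #-rich^ : ∀ k h → n * # h ≤ n * # (rich^ k h) + k * ((t + (t + t)) * 2 ^ n)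
  #-rich^ zero    h = ≤-reflexive (sym (+-identityʳ _))
  #-rich^ (suc k) h = begin
    n * # h                                       ≤⟨ #-rich^ k h ⟩
    n * # (rich^ k h) + k * c                     ≤⟨ +-monoˡ-≤ (k * c) (#-rich (rich^ k h)) ⟩
    n * # (rich^ (suc k) h) + c + k * c           ≡⟨ +-assoc _ c (k * c) ⟩
    n * # (rich^ (suc k) h) + (c + k * c)         ∎
    where
    c = (t + (t + t)) * 2 ^ n

  rich⇒ : ∀ {h A} → rich h A ≡ true → h A ≡ true
  rich⇒ {h} {A} eq with h A
  ... | true = refl

  rich^⇒ : ∀ k {h A} → rich^ k h A ≡ true → h A ≡ true
  rich^⇒ zero    eq = eq
  rich^⇒ (suc k) eq = rich^⇒ k (rich⇒ {rich^ k _} eq)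

  fresh : ∀ {p q : Subset n} → ∣ q ∣ < ∣ p ∣ → ∃ λ x → x ∈ p × x ∉ q
  fresh {p} {q} q<p with Fin.any? (λ x → x ∈? p ×-dec ¬? (x ∈? q))
  ... | yes found = found
  ... | no  none  = contradiction (p⊆q⇒∣p∣≤∣q∣ p⊆q) (<⇒≱ q<p)
    where
    p⊆q : p ⊆ q
    p⊆q {x} x∈p with x ∈? q
    ... | yes x∈q = x∈q
    ... | no  x∉q = contradiction (x , x∈p , x∉q) none

  -- The greedy choice: more than `t` candidates cannot all lie among at most `t` used points.
  fresh-tabulate : ∀ {p : Fin n → Bool} {q} → ∣ q ∣ ≤ t → (t <ᵇ ∣ tabulate p ∣) ≡ true →
                   ∃ λ x → p x ≡ true × x ∉ q
  fresh-tabulate {p} q≤t t<p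
    with x , x∈ , x∉q ← fresh {tabulate p} (≤-<-trans q≤t (<ᵇ⇒< t ∣ tabulate p ∣ (Equivalence.from T-≡ t<p)))
    = x , trans (sym (lookup∘tabulate p x)) ([]=⇒lookup x∈) , x∉q

-- Chains of swaps

∣p∪⁅x⁆∣≤ : (p : Subset n) (x : Fin n) → ∣ p ∪ ⁅ x ⁆ ∣ ≤ suc ∣ p ∣
∣p∪⁅x⁆∣≤ (true  ∷ p) zero    = m≤n⇒m≤1+n (≤-reflexive (cong (suc ∘ ∣_∣) (∪-identityʳ p)))
∣p∪⁅x⁆∣≤ (false ∷ p) zero    = ≤-reflexive (cong (suc ∘ ∣_∣) (∪-identityʳ p))
∣p∪⁅x⁆∣≤ (true  ∷ p) (suc x) = s≤s (∣p∪⁅x⁆∣≤ p x)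
∣p∪⁅x⁆∣≤ (false ∷ p) (suc x) = ∣p∪⁅x⁆∣≤ p x

-- The exact count gives the deleted set exactly `l` elements, as the trace hypothesis demands.
x∉p⇒∣p∪⁅x⁆∣ : (p : Subset n) (x : Fin n) → x ∉ p → ∣ p ∪ ⁅ x ⁆ ∣ ≡ suc ∣ p ∣
x∉p⇒∣p∪⁅x⁆∣ p x x∉p = ≤-antisym (∣p∪⁅x⁆∣≤ p x)
  (p⊂q⇒∣p∣<∣q∣ (p⊆p∪q ⁅ x ⁆ , x , x∈p∪q⁺ (inj₂ (x∈⁅x⁆ x)) , x∉p))

x∉p∪q⁻ : ∀ {p q : Subset n} {x} → x ∉ p ∪ q → x ∉ p × x ∉ q
x∉p∪q⁻ x∉ = x∉ ∘ x∈p∪q⁺ ∘ inj₁ , x∉ ∘ x∈p∪q⁺ ∘ inj₂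

∧-true⁻ : ∀ {a b} → a ∧ b ≡ true → a ≡ true × b ≡ true
∧-true⁻ {true} b≡true = refl , b≡true

does-true⁻ : ∀ {ℓ} {P : Set ℓ} (P? : Dec P) → does P? ≡ true → P
does-true⁻ (yes p) _ = p

lookup-false⇒∉ : ∀ {x} {A : Subset n} → lookup A x ≡ false → x ∉ A
lookup-false⇒∉ eq x∈A with () ← trans (sym ([]=⇒lookup x∈A)) eq

lookup-flip-≢ : ∀ {x w} → w ≢ x → (A : Subset n) → lookup (flip x A) w ≡ lookup A w
lookup-flip-≢ {x = x} {w} = lookup∘updateAt′ w x

-- Only properties of the result are recorded, so that removing first and inserting first yield the
-- same data.
record Swap (h : Subset n → Bool) (F T : Subset n) : Set where
  field
    target      : Subset n
    target∈h    : h target ≡ true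
    out new     : Fin n
    out∉T       : out ∉ T
    new∉T       : new ∉ T
    out≢new     : out ≢ new
    new∉F       : new ∉ F
    new∈target  : new ∈ target
    kept        : ∀ {w} → w ≢ out → w ∈ F → w ∈ target

-- `L`, the set to be deleted, is complete only after the last swap, while the chain grows at its
-- front. `L₀` is the part of `L` fixed beforehand, and `avoids` forbids later swaps to delete other
-- points of `T`.
record SwapChain (h : Subset n → Bool) (k : ℕ) (F T L₀ : Subset n) : Set where
  field
    chain      : Fin (suc k) → Subset n
    chain∈h    : ∀ i → h (chain i) ≡ true
    head≡      : chain zero ≡ F
    L          : Subset n
    L₀⊆L       : L₀ ⊆ L
    ∣L∣        : ∣ L ∣ ≡ ∣ L₀ ∣ + k
    avoids     : ∀ {x} → x ∈ T → x ∈ L → x ∈ L₀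
    increasing : ∀ i → chain (inject₁ i) ∩ ∁ L ⊂ chain (suc i) ∩ ∁ L

-- T collects the points already used, L₀ ⊆ T those already swapped out; since later swaps
-- avoid T, every new point of an earlier swap survives the deletion of L.
module _ {n : ℕ} {h h′ : Subset n → Bool} {k : ℕ} {F T L₀ : Subset n} (F∈h : h F ≡ true) (L₀⊆T : L₀ ⊆ T)
         (s : Swap h′ F T)
         (tail : SwapChain h k (Swap.target s)
                   ((T ∪ ⁅ Swap.out s ⁆) ∪ ⁅ Swap.new s ⁆) (L₀ ∪ ⁅ Swap.out s ⁆)) where
  private
    open Swap s
    open SwapChain tail
    L∩T⊆L₀ : ∀ {x} → x ∈ T → x ∈ L → x ∈ L₀
    L∩T⊆L₀ x∈T x∈L =
      [ id , (λ x∈⁅out⁆ → contradiction (subst (_∈ T) (x∈⁅y⁆⇒x≡y out x∈⁅out⁆) x∈T) out∉T) ]′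
      (x∈p∪q⁻ L₀ ⁅ out ⁆ (avoids (x∈p∪q⁺ (inj₁ (x∈p∪q⁺ (inj₁ x∈T)))) x∈L))
    out∈L : out ∈ L
    out∈L = L₀⊆L (x∈p∪q⁺ (inj₂ (x∈⁅x⁆ out)))
    new∉L : new ∉ L
    new∉L new∈L = [ new∉T ∘ L₀⊆T , (λ new∈⁅out⁆ → out≢new (sym (x∈⁅y⁆⇒x≡y out new∈⁅out⁆))) ]′
      (x∈p∪q⁻ L₀ ⁅ out ⁆ (avoids (x∈p∪q⁺ (inj₂ (x∈⁅x⁆ new))) new∈L))
    step : F ∩ ∁ L ⊂ target ∩ ∁ L
    -- The only point that `F` may lose is `out`, which `L` deletes anyway; `new` survives and makes
    -- the inclusion strict.
    step = (λ x∈ → let x∈F , x∈∁L = x∈p∩q⁻ F (∁ L) x∈ in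
               x∈p∩q⁺ (kept (λ { refl → x∈∁p⇒x∉p x∈∁L out∈L }) x∈F , x∈∁L))
         , new , x∈p∩q⁺ (new∈target , x∉p⇒x∈∁p new∉L) , new∉F ∘ proj₁ ∘ x∈p∩q⁻ F (∁ L)

  prepend : SwapChain h (suc k) F T L₀
  prepend = record
    { chain = F Vector.∷ chain
    ; chain∈h = λ { zero → F∈h ; (suc i) → chain∈h i }
    ; head≡ = refl
    ; L = L
    ; L₀⊆L = L₀⊆L ∘ x∈p∪q⁺ ∘ inj₁
    ; ∣L∣ = trans ∣L∣ (trans (cong (_+ k) (x∉p⇒∣p∪⁅x⁆∣ L₀ out (out∉T ∘ L₀⊆T))) (sym (+-suc ∣ L₀ ∣ k)))
    ; avoids = L∩T⊆L₀
    ; increasing = λ { zero → subst (λ G → F ∩ ∁ L ⊂ G ∩ ∁ L) (sym head≡) step ; (suc i) → increasing i }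
    }

module _ {n : ℕ} (t : ℕ) where
  open Richness {n} t

  -- Two greedy choices: a swappable `x` outside `T`, then a returning flip `x′` outside
  -- `T ∪ ⁅ x ⁆`, whence the room for one more point.
  swap : ∀ h {F T} → suc ∣ T ∣ ≤ t → rich h F ≡ true → Swap h F T
  swap h {F} {T} T<t F-rich
    with x , x-swappable , x∉T ← fresh-tabulate {swappable h F} {T} (<⇒≤ T<t) (proj₂ (∧-true⁻ {h F} F-rich))
    with x′ , x′-nbr , x′∉ ← fresh-tabulate {neighbour h (not (lookup F x)) (flip x F)} {T ∪ ⁅ x ⁆}
                               (≤-trans (∣p∪⁅x⁆∣≤ T x) T<t) x-swappable
    with x′-side , target∈h ← ∧-true⁻ {does (lookup (flip x F) x′ Bool.≟ not (lookup F x))} x′-nbr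
    with x′∉T , x′∉⁅x⁆ ← x∉p∪q⁻ {p = T} x′∉
    = build (lookup F x) refl
    where
    target = flip x′ (flip x F)
    x′≢x : x′ ≢ x
    x′≢x refl = x′∉⁅x⁆ (x∈⁅x⁆ x)
    -- The two points have different bits in `F`, so one leaves and the other enters; the bit of `x`
    -- decides which is `out`.
    x′-opposite : lookup F x′ ≡ not (lookup F x)
    x′-opposite = trans (sym (lookup-flip-≢ x′≢x F)) (does-true⁻ (_ Bool.≟ _) x′-side)
    elsewhere : ∀ {w} → w ≢ x → w ≢ x′ → w ∈ F → w ∈ target
    elsewhere w≢x w≢x′ w∈F = lookup⇒[]= _ target
      (trans (lookup-flip-≢ w≢x′ (flip x F)) (trans (lookup-flip-≢ w≢x F) ([]=⇒lookup w∈F)))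
    build : ∀ b → lookup F x ≡ b → Swap h F T
    build true eq = record
      { target = target ; target∈h = target∈h ; out = x ; new = x′
      ; out∉T = x∉T ; new∉T = x′∉T ; out≢new = x′≢x ∘ sym ; new∉F = x′∉F
      ; new∈target = lookup⇒[]= x′ target (trans (lookup∘updateAt x′ (flip x F))
          (cong not (trans (lookup-flip-≢ x′≢x F) x′-false)))
      ; kept = λ w≢x w∈F → elsewhere w≢x (λ { refl → x′∉F w∈F }) w∈F
      }
      where
      x′-false : lookup F x′ ≡ false
      x′-false = trans x′-opposite (cong not eq)
      x′∉F : x′ ∉ F
      x′∉F = lookup-false⇒∉ x′-false
    build false eq = record
      { target = target ; target∈h = target∈h ; out = x′ ; new = x
      ; out∉T = x′∉T ; new∉T = x∉T ; out≢new = x′≢x ; new∉F = x∉F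
      ; new∈target = lookup⇒[]= x target (trans (lookup-flip-≢ (x′≢x ∘ sym) (flip x F))
          (trans (lookup∘updateAt x F) (cong not eq)))
      ; kept = λ w≢x′ w∈F → elsewhere (λ { refl → x∉F w∈F }) w≢x′ w∈F
      }
      where
      x∉F : x ∉ F
      x∉F = lookup-false⇒∉ eq

  -- Each swap descends one level of richness and uses up two points, hence the reserve `2 * k`.
  swapChain : ∀ k {h F T L₀} → rich^ k h F ≡ true → L₀ ⊆ T → ∣ T ∣ + 2 * k ≤ t → SwapChain h k F T L₀
  swapChain zero {F = F} {L₀ = L₀} F∈h _ _ = record
    { chain = λ _ → F ; chain∈h = λ _ → F∈h ; head≡ = refl ; L = L₀ ; L₀⊆L = id
    ; ∣L∣ = sym (+-identityʳ _) ; avoids = λ _ x∈L → x∈L ; increasing = λ () }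
  swapChain (suc k) {h} {F} {T} {L₀} F-rich L₀⊆T room =
    extend (swap (rich^ k h) {F} {T} (≤-trans (n≤1+n _) (m+n≤o⇒m≤o _ room′)) F-rich)
    where
    regroup : ∀ a k → a + 2 * suc k ≡ suc (suc a) + 2 * k
    regroup = solve-∀
    room′ : suc (suc ∣ T ∣) + 2 * k ≤ t
    room′ = subst (_≤ t) (regroup ∣ T ∣ k) room
    extend : Swap (rich^ k h) F T → SwapChain h (suc k) F T L₀
    extend s = prepend (rich^⇒ (suc k) F-rich) L₀⊆T s
      (swapChain k {h} {target} {(T ∪ ⁅ out ⁆) ∪ ⁅ new ⁆} {L₀ ∪ ⁅ out ⁆} target∈h
        (λ x∈ → x∈p∪q⁺ (inj₁ (x∈p∪q⁺ ([ inj₁ ∘ L₀⊆T , inj₂ ]′ (x∈p∪q⁻ L₀ ⁅ out ⁆ x∈)))))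
        (≤-trans (+-monoˡ-≤ (2 * k)
          (≤-trans (∣p∪⁅x⁆∣≤ (T ∪ ⁅ out ⁆) new) (s≤s (∣p∪⁅x⁆∣≤ T out)))) room′))
      where open Swap s

-- The size of the family

-- A member of `rich^ l` would start a forbidden chain, so after `l` passes nothing remains. Each
-- pass loses at most `3 * t * 2 ^ n`, and `3 * t = 6 * l`.
traceSperner⇒n*∣𝓕∣≤ : ∀ l (𝓕 : Family n) → Unique 𝓕 → TraceKSperner (n ∸ l) l 𝓕 →
                      n * length 𝓕 ≤ l * (6 * l) * 2 ^ n
traceSperner⇒n*∣𝓕∣≤ {n} l 𝓕 uniq sperner = begin
  n * length 𝓕                                       ≤⟨ *-monoʳ-≤ n (length≤# 𝓕 uniq) ⟩
  n * # member                                       ≤⟨ #-rich^ l member ⟩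
  n * # (rich^ l member) + l * ((t + (t + t)) * 2 ^ n)
    ≤⟨ +-monoˡ-≤ _ (*-monoʳ-≤ n (≤-trans (∑⊆-mono none) (≤-reflexive (∑⊆-const n 0)))) ⟩
  n * 0 + l * ((t + (t + t)) * 2 ^ n)                ≡⟨ regroup n l (2 ^ n) ⟩
  l * (6 * l) * 2 ^ n                                ∎
  where
  -- All points used by `l` swaps.
  t = 2 * l
  open Richness {n} t
  member : Subset n → Bool
  member A = does (A ∈ᴸ? 𝓕)
  regroup : ∀ n l a → n * 0 + l * ((2 * l + (2 * l + 2 * l)) * a) ≡ l * (6 * l) * a
  regroup = solve-∀
  not-rich : ∀ A → rich^ l member A ≢ true
  -- Starting with nothing used or deleted gives `∣ L ∣ ≡ l`, so `∁ L` has `n ∸ l` points.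
  not-rich A A-rich = sperner (∁ L)
    (trans (∣∁p∣≡n∸∣p∣ L) (cong (n ∸_) (trans ∣L∣ (cong (_+ l) (∣⊥∣≡0 n)))))
    (λ i → chain i ∩ ∁ L)
    ((λ i → chain i , does-true⁻ (chain i ∈ᴸ? 𝓕) (chain∈h i) , refl) , increasing)
    where
    open SwapChain (swapChain t l {member} {A} {⊥} {⊥} A-rich id
                      (≤-reflexive (cong (_+ 2 * l) (∣⊥∣≡0 n))))
  none : ∀ A → 𝟙 (rich^ l member A) ≤ 0
  none A with rich^ l member A in eq
  ... | true  = contradiction eq (not-rich A)
  ... | false = z≤n

theorem3p2 : (l′ : ℕ) → .{{_ : NonZero l′}} →
    ∃ λ (K : ℕ) → (n : ℕ) → l′ ≤ n → (𝓕 : Family n) → Unique 𝓕 →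
    TraceKSperner (n ∸ l′) l′ 𝓕 →
    (length 𝓕) ^ 3 * n ≤ K * (n C (n / 2)) ^ 3
theorem3p2 l′ = 8 * M ^ 3 , bound
  where
  M = l′ * (6 * l′)
  bound : (n : ℕ) → l′ ≤ n → (𝓕 : Family n) → Unique 𝓕 → TraceKSperner (n ∸ l′) l′ 𝓕 →
          (length 𝓕) ^ 3 * n ≤ 8 * M ^ 3 * (n C (n / 2)) ^ 3
  -- With the factor `n * n` the left side becomes the cube of `n * f`; the same factor appears on
  -- the right from the bound for `(2 ^ n) ^ 3`, together with the 8.
  bound n l′≤n 𝓕 uniq sperner = *-cancelˡ-≤ (n * n) (begin
    n * n * (f ^ 3 * n)                  ≡⟨ cube-* n f ⟩
    (n * f) ^ 3                          ≤⟨ ^-monoˡ-≤ 3 (traceSperner⇒n*∣𝓕∣≤ l′ 𝓕 uniq sperner) ⟩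
    (M * 2 ^ n) ^ 3                      ≡⟨ cube-distrib M (2 ^ n) ⟩
    M ^ 3 * (2 ^ n) ^ 3                  ≤⟨ *-monoʳ-≤ (M ^ 3) ([2^n]³≤ n) ⟩
    M ^ 3 * (8 * (n * n) * c ^ 3)        ≡⟨ regroup (M ^ 3) (n * n) (c ^ 3) ⟩
    n * n * (8 * M ^ 3 * c ^ 3)          ∎)
    where
    f = length 𝓕
    c = n C (n / 2)
    instance
      n≢0 : NonZero n
      n≢0 = >-nonZero (<-≤-trans (>-nonZero⁻¹ l′) l′≤n)
      n*n≢0 : NonZero (n * n)
      n*n≢0 = m*n≢0 n n
    cube-* : ∀ n f → n * n * (f * (f * (f * 1)) * n) ≡ (n * f) * ((n * f) * ((n * f) * 1))
    cube-* = solve-∀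
    cube-distrib : ∀ m a → (m * a) * ((m * a) * ((m * a) * 1)) ≡ m * (m * (m * 1)) * (a * (a * (a * 1)))
    cube-distrib = solve-∀
    regroup : ∀ m a b → m * (8 * a * b) ≡ a * (8 * m * b)
    regroup = solve-∀
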